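{- (1) For $n\geq 1$, a $2$-null CRC in $G_n$ with covering radius $\rho\geq 2$, $c_1=1$ and $c_2=3$ exists if and only if $n=2$; in that case its parameter matrix is $[0,4|1,0,3|3,0,1|4,0]$ (realized by the set of even-weight words of a perfect code in $G_2$). (2) For no $n\geq 1$ is there a $2$-null CRC in $G_n$ with covering radius $\rho\geq 2$, $c_1=2$ and $c_2=3$.
   Context: $G_n$: vertex set $\mathbb{Z}^n$, $x\sim y$ iff $\sum_i|x_i-y_i|=1$; weight of $x$ is $\sum_i|x_i|$. For a code $C$ with covering radius $\rho=\max_v d(v,C)$, $C_i=\{v:d(v,C)=i\}$. $C$ is a CRC if for all $i,j$ every vertex of $C_i$ has the same number $\alpha_{ij}$ of neighbours in $C_j$, with $\alpha_{ij}=0$ for $|i-j|>1$; $a_i=\alpha_{ii}$, $b_i=\alpha_{i,i+1}$, $c_i=\alpha_{i,i-1}$, parameter matrix written $[a_0,b_0|c_1,a_1,b_1|\ldots|c_\rho,a_\rho]$. $C$ is $r$-null if $a_0=\cdots=a_{r-1}=0$. A perfect code in $G_n$ is a vertex set meeting every closed ball of radius one in exactly one vertex. -}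

module Defs where

open import Level using (0ℓ)
open import Data.Nat using (ℕ; zero; suc; pred; _≤_; _<_; _<ᵇ_; ∣_-_∣)
open import Data.Nat.Divisibility using (_∣_)
open import Data.Integer as ℤ using (ℤ)
open import Data.Bool using (if_then_else_)
open import Data.List using (List; []; _∷_; _++_; length; applyUpTo)
open import Data.List.Membership.Propositional using () renaming (_∈_ to _∈ˡ_)
open import Data.List.Relation.Unary.Unique.Propositional using (Unique)
open import Data.Vec as Vec using (Vec)
open import Data.Product using (_×_; ∃-syntax; ∃!)
open import Function.Bundles using (_⇔_)
open import Relation.Binary.PropositionalEquality using (_≡_)
open import Relation.Unary using (Pred; _∈_)

Vertex : ℕ → Set
Vertex n = Vec ℤ n

weight : ∀ {n} → Vertex n → ℕ
weight x = Vec.sum (Vec.map ℤ.∣_∣ x)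

infix 4 _∼_

_∼_ : ∀ {n} → Vertex n → Vertex n → Set
x ∼ y = weight (Vec.zipWith ℤ._-_ x y) ≡ 1

infixr 5 _◅_

data Walk {n : ℕ} : ℕ → Vertex n → Vertex n → Set where
  ε   : ∀ {x} → Walk 0 x x
  _◅_ : ∀ {k x y z} → x ∼ y → Walk k y z → Walk (suc k) x z

-- d(x , y) = k, as a relation.
Dist : ∀ {n} → Vertex n → Vertex n → ℕ → Set
Dist x y k = Walk k x y × (∀ m → Walk m x y → k ≤ m)

Code : ℕ → Set₁
Code n = Pred (Vertex n) 0ℓ

-- Layer C i is the set Cᵢ of vertices v with d(v , C) = min { d(v , x) : x ∈ C } = i.
Layer : ∀ {n} → Code n → ℕ → Code n
Layer C i v =
  (∃[ x ] (x ∈ C × Dist v x i)) × (∀ x m → x ∈ C → Dist v x m → i ≤ m)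

-- In particular C is nonempty.
IsCoveringRadius : ∀ {n} → Code n → ℕ → Set
IsCoveringRadius C ρ =
  (∀ v → ∃[ i ] (i ≤ ρ × v ∈ Layer C i)) × (∃[ v ] v ∈ Layer C ρ)

-- Exactly k neighbours of v lie in S.
NeighbourCount : ∀ {n} → Vertex n → Code n → ℕ → Set
NeighbourCount v S k =
  ∃[ ys ] (Unique ys × length ys ≡ k × (∀ y → y ∈ˡ ys ⇔ (v ∼ y × y ∈ S)))

-- Only the entries α i j with i , j ≤ ρ are meaningful.
Parameters : Set
Parameters = ℕ → ℕ → ℕ

record IsCRC {n : ℕ} (C : Code n) (ρ : ℕ) (α : Parameters) : Set where
  field
    coveringRadius : IsCoveringRadius C ρ
    regular        : ∀ i j → i ≤ ρ → j ≤ ρ →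
                     ∀ v → v ∈ Layer C i → NeighbourCount v (Layer C j) (α i j)
    tridiagonal    : ∀ i j → i ≤ ρ → j ≤ ρ → 1 < ∣ i - j ∣ → α i j ≡ 0

a b c : Parameters → ℕ → ℕ
a α i = α i i
b α i = α i (suc i)
c α i = α i (pred i)

IsNull : ℕ → Parameters → Set
IsNull r α = ∀ i → i < r → a α i ≡ 0

-- The list of rows a₀,b₀ | c₁,a₁,b₁ | … | c_ρ,a_ρ.
parameterMatrix : Parameters → ℕ → List (List ℕ)
parameterMatrix α ρ = applyUpTo row (suc ρ)
  where
  lower : ℕ → List ℕ
  lower zero    = []
  lower (suc i) = c α (suc i) ∷ []

  upper : ℕ → List ℕ
  upper i = if i <ᵇ ρ then b α i ∷ [] else []

  row : ℕ → List ℕ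
  row i = lower i ++ a α i ∷ upper i

-- A 2-null CRC with covering radius ρ ≥ 2, c₁ = p and c₂ = q.
Is2NullCRC : ∀ {n} → ℕ → ℕ → Code n → ℕ → Parameters → Set
Is2NullCRC p q C ρ α =
  IsCRC C ρ α × IsNull 2 α × 2 ≤ ρ × c α 1 ≡ p × c α 2 ≡ q

ClosedBall : ∀ {n} → Vertex n → ℕ → Code n
ClosedBall v r y = ∃[ k ] (k ≤ r × Dist v y k)

IsPerfect : ∀ {n} → Code n → Set
IsPerfect P = ∀ v → ∃! _≡_ (λ y → y ∈ P × y ∈ ClosedBall v 1)

evenWords : ∀ {n} → Code n → Code n
evenWords P x = x ∈ P × 2 ∣ weight x

{-# OPTIONS --safe #-}
module Submission where

-- Everything is local around a codeword x, with "directions" the 2n unit vectors.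
--
-- c₁ = 1.  For directions d, e on different axes, x + d + e has the C₁-neighbours
-- x + d and x + e; counting C₁-neighbours shows that the codeword behind the third
-- one is x + 3d + e or x + d + 3e.  So every pair {d, e} is oriented, and x + 2d
-- having only three C₁-neighbours bounds the out-degree of d by one.  There are
-- 2n(n - 1) pairs and 2n directions, so n ≤ 2.  For n = 2 the orientation is a
-- directed 4-cycle; if x + 3d + e is a codeword then so is x - d + 3e, and all
-- neighbours of x + d + 2e lie in C₂, which fixes the remaining parameters.
--
-- c₁ = 2.  For y in C₂ join directions p, q when y + p + q is a codeword.  Counting
-- forces a path p - m - q on the three directions leading to C₁.  If q ≠ -p then
-- y + p + q has four C₁-neighbours; if q = -p then y + m + 2p has three
-- codeword neighbours.
--
-- The code for n = 2 is {(x , y) : x + 7y ≡ 0 mod 10}, and the level of a vertex is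
-- the distance of x + 7y from 0 in the circulant graph on ℤ/10 with steps ±1, ±3.

open import Data.Nat using (ℕ; zero; suc; _+_; _≤_; _<_; z≤n; s≤s; s≤s⁻¹; parity; ∣_-_∣)
open import Data.Nat.Properties using (_≟_; _<?_; ≤-refl; ≤-trans; ≤-antisym; ≤-reflexive; <-irrefl; <-≤-trans; ≮⇒≥; ≤∧≢⇒<; n≤1+n; +-suc; m+n≡0⇒m≡0; m+n≡0⇒n≡0; +-identityʳ; suc-injective; _≤?_; 1+n≰n)
open import Data.Nat.DivMod using (_mod_)
open import Data.Nat.Divisibility using (_∣_; _∣?_; _∣0; divides; ∣-refl; ∣m∣n⇒∣m+n)
open import Data.Nat.Induction using (<-rec)
open import Data.Integer as ℤ using (ℤ; +_; -[1+_])
import Data.Integer.Properties as ℤ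
open import Data.Integer.Tactic.RingSolver using (solve-∀)
open import Data.Fin as Fin using (Fin; zero; suc)
import Data.Fin.Properties as Fin
open import Data.Parity as ℙ using (Parity; 0ℙ; 1ℙ; _⁻¹)
import Data.Parity.Properties as ℙ
open import Data.Sign as Sign using (Sign; opposite)
import Data.Sign.Properties as Sign
open import Data.List using (List; []; _∷_; _++_; length; map; filter)
open import Data.List.Properties using (length-++; length-map)
open import Data.List.Membership.Propositional using (_∉_; find; lose) renaming (_∈_ to _∈ˡ_)
open import Data.List.Membership.Propositional.Properties using (∈-∃++; ∈-++⁻; ∈-++⁺ˡ; ∈-++⁺ʳ; ∈-map⁺; ∈-map⁻; ∈-filter⁺; ∈-filter⁻)
open import Data.List.Relation.Unary.Any as Any using (Any; here; there; any?)
open import Data.List.Relation.Unary.All as All using (All; []; _∷_)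
open import Data.List.Relation.Unary.AllPairs using ([]; _∷_)
open import Data.List.Relation.Unary.Unique.Propositional using (Unique)
open import Data.List.Relation.Unary.Unique.Propositional.Properties using () renaming (map⁺ to Unique-map⁺; filter⁺ to Unique-filter⁺)
open import Data.Vec as Vec using ([]; _∷_; updateAt; lookup)
import Data.Vec.Properties as Vec
open import Data.Product using (_×_; _,_; proj₁; proj₂; ∃-syntax; ∃!)
open import Data.Product.Properties using (≡-dec)
open import Data.Sum using (_⊎_; inj₁; inj₂; [_,_]′)
open import Data.Empty using (⊥; ⊥-elim)
open import Function using (_∘_; id)
open import Function.Bundles using (_⇔_; mk⇔; Equivalence)
open import Relation.Nullary using (¬_; Dec; yes; no; contradiction; ¬?)
open import Relation.Nullary.Decidable using (decidable-stable; True; toWitness; _×-dec_; _⊎-dec_; _→-dec_)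
open import Relation.Unary using (_∈_)
open import Relation.Binary.Definitions using (DecidableEquality)
open import Relation.Binary.PropositionalEquality using (_≡_; _≢_; refl; sym; trans; cong; cong₂; subst; ≢-sym; module ≡-Reasoning)
open import Defs

private variable
  n i j k : ℕ

-- Directions of the grid

Dir : ℕ → Set
Dir n = Fin n × Sign

infix 9 ⊖_
infixl 6 _⊕_

-- Opaque, so that directions can be inferred from v ⊕ d, ⊖ d and axis d.
opaque

  axis : Dir n → Fin n
  axis = proj₁

  ⊖_ : Dir n → Dir n
  ⊖ (i , s) = i , opposite s

_≟ᵈ_ : DecidableEquality (Dir n)
_≟ᵈ_ = ≡-dec Fin._≟_ Sign._≟_

step : Sign → ℤ → ℤ
step Sign.+ = ℤ.suc
step Sign.- = ℤ.pred

opaque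

  _⊕_ : Vertex n → Dir n → Vertex n
  v ⊕ (i , s) = updateAt v i (step s)

opaque
  unfolding axis ⊖_

  ⊖-involutive : (d : Dir n) → ⊖ ⊖ d ≡ d
  ⊖-involutive (i , s) = cong (i ,_) (Sign.opposite-involutive s)

  axis-⊖ : (d : Dir n) → axis (⊖ d) ≡ axis d
  axis-⊖ d = refl

  d≢⊖d : (d : Dir n) → d ≢ ⊖ d
  d≢⊖d (i , s) = Sign.s≢opposite[s] s ∘ cong proj₂

  ≢∧≢⊖⇒axis≢ : {d e : Dir n} → d ≢ e → d ≢ ⊖ e → axis d ≢ axis e
  ≢∧≢⊖⇒axis≢ {d = i , Sign.+} {.i , Sign.+} d≢e _ refl = d≢e refl
  ≢∧≢⊖⇒axis≢ {d = i , Sign.+} {.i , Sign.-} _ d≢⊖e refl = d≢⊖e refl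
  ≢∧≢⊖⇒axis≢ {d = i , Sign.-} {.i , Sign.+} _ d≢⊖e refl = d≢⊖e refl
  ≢∧≢⊖⇒axis≢ {d = i , Sign.-} {.i , Sign.-} d≢e _ refl = d≢e refl

axis≢⇒≢ : {d e : Dir n} → axis d ≢ axis e → d ≢ e
axis≢⇒≢ axis≢ refl = axis≢ refl

⊖-axisˡ : {d e : Dir n} → axis d ≢ axis e → axis (⊖ d) ≢ axis e
⊖-axisˡ {d = d} axis≢ eq = axis≢ (trans (sym (axis-⊖ d)) eq)

⊖-axisʳ : {d e : Dir n} → axis d ≢ axis e → axis d ≢ axis (⊖ e)
⊖-axisʳ {e = e} axis≢ eq = axis≢ (trans eq (axis-⊖ e))

axis≡⇒≡⊎≡⊖ : {d e : Dir n} → axis d ≡ axis e → d ≡ e ⊎ d ≡ ⊖ e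
axis≡⇒≡⊎≡⊖ {d = d} {e} eq with d ≟ᵈ e | d ≟ᵈ (⊖ e)
... | yes d≡e | _        = inj₁ d≡e
... | no _    | yes d≡⊖e = inj₂ d≡⊖e
... | no d≢e  | no d≢⊖e  = contradiction eq (≢∧≢⊖⇒axis≢ d≢e d≢⊖e)

step-comm : ∀ s t x → step s (step t x) ≡ step t (step s x)
step-comm Sign.+ Sign.+ x = refl
step-comm Sign.+ Sign.- x = trans (ℤ.suc-pred x) (sym (ℤ.pred-suc x))
step-comm Sign.- Sign.+ x = trans (ℤ.pred-suc x) (sym (ℤ.suc-pred x))
step-comm Sign.- Sign.- x = refl

step-opposite : ∀ s x → step (opposite s) (step s x) ≡ x
step-opposite Sign.+ = ℤ.pred-suc
step-opposite Sign.- = ℤ.suc-pred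

opaque
  unfolding ⊖_ _⊕_

  ⊕-comm : ∀ (v : Vertex n) d e → v ⊕ d ⊕ e ≡ v ⊕ e ⊕ d
  ⊕-comm (x ∷ v) (zero , s)  (zero , t)  = cong (_∷ v) (step-comm t s x)
  ⊕-comm (x ∷ v) (zero , s)  (suc j , t) = refl
  ⊕-comm (x ∷ v) (suc i , s) (zero , t)  = refl
  ⊕-comm (x ∷ v) (suc i , s) (suc j , t) = cong (x ∷_) (⊕-comm v (i , s) (j , t))

  ⊕-⊖ : ∀ (v : Vertex n) d → v ⊕ d ⊕ ⊖ d ≡ v
  ⊕-⊖ (x ∷ v) (zero , s)  = cong (_∷ v) (step-opposite s x)
  ⊕-⊖ (x ∷ v) (suc i , s) = cong (x ∷_) (⊕-⊖ v (i , s))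

⊖-⊕ : ∀ (v : Vertex n) d → v ⊕ ⊖ d ⊕ d ≡ v
⊖-⊕ v d = trans (⊕-comm v (⊖ d) d) (⊕-⊖ v d)

⊕⊕-⊖ : ∀ (v : Vertex n) d e → v ⊕ d ⊕ e ⊕ ⊖ d ≡ v ⊕ e
⊕⊕-⊖ v d e = trans (cong (_⊕ ⊖ d) (⊕-comm v d e)) (⊕-⊖ (v ⊕ e) d)

⊕⊕⊕-⊖ : ∀ (v : Vertex n) d e f → v ⊕ d ⊕ e ⊕ f ⊕ ⊖ d ≡ v ⊕ e ⊕ f
⊕⊕⊕-⊖ v d e f = trans (⊕-comm (v ⊕ d ⊕ e) f (⊖ d)) (cong (_⊕ f) (⊕⊕-⊖ v d e))

step-fixpoint-free : ∀ s x → step s x ≢ x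
step-fixpoint-free Sign.+ x = ℤ.i≢suc[i] ∘ sym
step-fixpoint-free Sign.- (+ zero) ()
step-fixpoint-free Sign.- (+ suc n) ()
step-fixpoint-free Sign.- -[1+ n ] ()

step-injective : ∀ s t x → step s x ≡ step t x → s ≡ t
step-injective Sign.+ Sign.+ x eq = refl
step-injective Sign.- Sign.- x eq = refl
step-injective Sign.+ Sign.- (+ zero) ()
step-injective Sign.+ Sign.- (+ suc n) ()
step-injective Sign.+ Sign.- -[1+ zero ] ()
step-injective Sign.+ Sign.- -[1+ suc n ] ()
step-injective Sign.- Sign.+ (+ zero) ()
step-injective Sign.- Sign.+ (+ suc n) ()
step-injective Sign.- Sign.+ -[1+ zero ] ()
step-injective Sign.- Sign.+ -[1+ suc n ] ()

opaque
  unfolding _⊕_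

  -- With `∼⇒⊕` this makes counting neighbours of `v` the same as counting directions.
  ⊕-injective : ∀ (v : Vertex n) {d e} → v ⊕ d ≡ v ⊕ e → d ≡ e
  ⊕-injective (x ∷ v) {zero , s}  {zero , t}  eq =
    cong (zero ,_) (step-injective s t x (Vec.∷-injectiveˡ eq))
  ⊕-injective (x ∷ v) {zero , s}  {suc j , t} eq =
    contradiction (Vec.∷-injectiveˡ eq) (step-fixpoint-free s x)
  ⊕-injective (x ∷ v) {suc i , s} {zero , t}  eq =
    contradiction (sym (Vec.∷-injectiveˡ eq)) (step-fixpoint-free t x)
  ⊕-injective (x ∷ v) {suc i , s} {suc j , t} eq
    with refl ← ⊕-injective v {i , s} {j , t} (Vec.∷-injectiveʳ eq) = refl

weight-self : (v : Vertex n) → weight (Vec.zipWith ℤ._-_ v v) ≡ 0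
weight-self []      = refl
weight-self (x ∷ v) = cong₂ _+_ (cong ℤ.∣_∣ (ℤ.+-inverseʳ x)) (weight-self v)

∣x-step∣≡1 : ∀ s x → ℤ.∣ x ℤ.- step s x ∣ ≡ 1
∣x-step∣≡1 Sign.+ x = cong ℤ.∣_∣ (lemma x)
  where
  lemma : ∀ x → x ℤ.- (ℤ.1ℤ ℤ.+ x) ≡ ℤ.-1ℤ
  lemma = solve-∀
∣x-step∣≡1 Sign.- x = cong ℤ.∣_∣ (lemma x)
  where
  lemma : ∀ x → x ℤ.- (ℤ.-1ℤ ℤ.+ x) ≡ ℤ.1ℤ
  lemma = solve-∀

∣x-y∣≡1⇒step : ∀ x y → ℤ.∣ x ℤ.- y ∣ ≡ 1 → ∃[ s ] y ≡ step s x
-- After `x ℤ.- y` is abstracted, `recover` reads `y ≡ - (x - y) + x`, so the values 1 and -1 turn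
-- it into `ℤ.pred x` and `ℤ.suc x` definitionally.
∣x-y∣≡1⇒step x y eq with x ℤ.- y | recover x y
  where
  recover : ∀ x y → y ≡ ℤ.- (x ℤ.- y) ℤ.+ x
  recover = solve-∀
... | + 1      | y≡ = Sign.- , y≡
... | -[1+ 0 ] | y≡ = Sign.+ , y≡

opaque
  unfolding _⊕_

  ∼-⊕ : ∀ (v : Vertex n) d → v ∼ v ⊕ d
  ∼-⊕ (x ∷ v) (zero , s)  = cong₂ _+_ (∣x-step∣≡1 s x) (weight-self v)
  ∼-⊕ (x ∷ v) (suc i , s) = cong₂ _+_ (cong ℤ.∣_∣ (ℤ.+-inverseʳ x)) (∼-⊕ v (i , s))

weight≡0⇒≡ : (v w : Vertex n) → weight (Vec.zipWith ℤ._-_ v w) ≡ 0 → v ≡ w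
weight≡0⇒≡ []      []      _  = refl
weight≡0⇒≡ (x ∷ v) (y ∷ w) eq = cong₂ _∷_
  (ℤ.i-j≡0⇒i≡j x y (ℤ.∣i∣≡0⇒i≡0 (m+n≡0⇒m≡0 ℤ.∣ x ℤ.- y ∣ eq)))
  (weight≡0⇒≡ v w (m+n≡0⇒n≡0 ℤ.∣ x ℤ.- y ∣ eq))

opaque
  unfolding _⊕_

  -- The coordinate differences sum to one: either the heads agree and the tails carry the
  -- difference, or the heads carry it and the tails agree.
  ∼⇒⊕ : (v w : Vertex n) → v ∼ w → ∃[ d ] w ≡ v ⊕ d
  ∼⇒⊕ []      []      ()
  ∼⇒⊕ (x ∷ v) (y ∷ w) eq with ℤ.∣ x ℤ.- y ∣ in ∣x-y∣≡k
  ... | zero =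
    let (i , s) , w≡v⊕d = ∼⇒⊕ v w eq
    in (suc i , s) , cong₂ _∷_ (sym (ℤ.i-j≡0⇒i≡j x y (ℤ.∣i∣≡0⇒i≡0 ∣x-y∣≡k))) w≡v⊕d
  ... | suc k =
    let k+w≡0 = suc-injective eq
        s , y≡ = ∣x-y∣≡1⇒step x y (trans ∣x-y∣≡k (cong suc (m+n≡0⇒m≡0 k k+w≡0)))
    in (zero , s) , cong₂ _∷_ y≡ (sym (weight≡0⇒≡ v w (m+n≡0⇒n≡0 k k+w≡0)))

-- Distance layers

module _ {C : Code n} where

  -- A walk shorter than the layer index would have a shortest one below it.
  Layer⇒minimal : ∀ {v x m} → Layer C i v → x ∈ C → Walk m v x → i ≤ m
  Layer⇒minimal {i = i} {v} {x} {m} (_ , minimal) x∈C walk = ≮⇒≥ λ m<i → no-walk m m<i walk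
    where
    no-walk : ∀ m → m < i → ¬ Walk m v x
    no-walk = <-rec _ λ m rec m<i walk → <-irrefl refl (<-≤-trans m<i (minimal x m x∈C
      (walk , λ m′ walk′ → ≮⇒≥ λ m′<m → rec m′<m (≤-trans m′<m (≤-trans (n≤1+n m) m<i)) walk′)))

  minimal⇒Layer : ∀ {v x} → x ∈ C → Walk i v x →
                  (∀ {y m} → y ∈ C → Walk m v y → i ≤ m) → Layer C i v
  minimal⇒Layer x∈C walk minimal =
    (_ , x∈C , walk , λ _ → minimal x∈C) , λ _ _ y∈C → minimal y∈C ∘ proj₁

  Layer-unique : ∀ {v} → Layer C i v → Layer C j v → i ≡ j
  Layer-unique v∈Cᵢ@((_ , x∈C , walk , _) , _) v∈Cⱼ@((_ , y∈C , walk′ , _) , _) =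
    ≤-antisym (Layer⇒minimal v∈Cᵢ y∈C walk′) (Layer⇒minimal v∈Cⱼ x∈C walk)

  Layer-adjacent : ∀ {v w} → w ∼ v → Layer C i v → Layer C j w → j ≤ suc i
  Layer-adjacent w∼v ((_ , x∈C , walk , _) , _) w∈Cⱼ = Layer⇒minimal w∈Cⱼ x∈C (w∼v ◅ walk)

  code⇒Layer-0 : ∀ {v} → v ∈ C → Layer C 0 v
  code⇒Layer-0 v∈C = minimal⇒Layer v∈C ε λ _ _ → z≤n

  Layer-descend : ∀ {v} → Layer C (suc i) v → ∃[ d ] Layer C i (v ⊕ d)
  Layer-descend {v = v} v∈C₁₊ᵢ@((x , x∈C , _◅_ {y = y} v∼y walk , _) , _)
    with d , refl ← ∼⇒⊕ v y v∼y =
    d , minimal⇒Layer x∈C walk λ z∈C walk′ → s≤s⁻¹ (Layer⇒minimal v∈C₁₊ᵢ z∈C (v∼y ◅ walk′))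

-- Counting neighbours

-- Pigeonhole: one occurrence of the head is cut out of `ys`, and uniqueness keeps the tail of `xs`
-- inside what remains.
Unique-⊆⇒length≤ : ∀ {A : Set} {xs ys : List A} →
                   Unique xs → (∀ {x} → x ∈ˡ xs → x ∈ˡ ys) → length xs ≤ length ys
Unique-⊆⇒length≤ []               _     = z≤n
Unique-⊆⇒length≤ {xs = x ∷ xs} (x∉xs ∷ uniq) xs⊆ys
  with as , bs , refl ← ∈-∃++ (xs⊆ys (here refl)) =
  ≤-trans (s≤s (Unique-⊆⇒length≤ uniq xs⊆as++bs)) (≤-reflexive (sym length-eq))
  where
  length-eq : length (as ++ x ∷ bs) ≡ suc (length (as ++ bs))
  length-eq rewrite length-++ as {x ∷ bs} | length-++ as {bs} = +-suc _ _

  xs⊆as++bs : ∀ {z} → z ∈ˡ xs → z ∈ˡ as ++ bs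
  xs⊆as++bs z∈xs with ∈-++⁻ as (xs⊆ys (there z∈xs))
  ... | inj₁ z∈as          = ∈-++⁺ˡ z∈as
  ... | inj₂ (here z≡x)    = contradiction (sym z≡x) (All.lookup x∉xs z∈xs)
  ... | inj₂ (there z∈bs)  = ∈-++⁺ʳ as z∈bs

_≟ᵛ_ : DecidableEquality (Vertex n)
_≟ᵛ_ = Vec.≡-dec ℤ._≟_

module _ {v : Vertex n} {S : Code n} where

  open import Data.List.Membership.DecPropositional (_≟ᵛ_ {n}) using (_∈?_)

  NeighbourCount-≥ : ∀ {ds} → NeighbourCount v S k → Unique ds →
                     All (λ d → v ⊕ d ∈ S) ds → length ds ≤ k
  NeighbourCount-≥ {ds = ds} (ys , _ , refl , ∈ys⇔) uniq all∈S =
    subst (_≤ length ys) (length-map (v ⊕_) ds)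
      (Unique-⊆⇒length≤ (Unique-map⁺ (⊕-injective v) uniq) λ y∈ →
        let d , d∈ds , y≡v⊕d = ∈-map⁻ (v ⊕_) y∈
        in subst (_∈ˡ ys) (sym y≡v⊕d)
             (Equivalence.from (∈ys⇔ (v ⊕ d)) (∼-⊕ v d , All.lookup all∈S d∈ds)))

  -- The search runs over the finite list that witnesses the count, so decidable equality of
  -- vertices suffices for an arbitrary `S`.
  NeighbourCount-> : ∀ ds → NeighbourCount v S k → length ds < k →
                     ∃[ d ] (d ∉ ds × v ⊕ d ∈ S)
  NeighbourCount-> ds (ys , uniq , refl , ∈ys⇔) ds<ys
    with any? (λ y → ¬? (y ∈? map (v ⊕_) ds)) ys
  ... | no none = contradiction
    (≤-trans ds<ys (Unique-⊆⇒length≤ uniq λ {y} y∈ys →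
      decidable-stable (y ∈? map (v ⊕_) ds) λ y∉ → none (lose y∈ys y∉)))
    (λ 1+ds≤ → 1+n≰n (subst (suc (length ds) ≤_) (length-map (v ⊕_) ds) 1+ds≤))
  ... | yes some
    with y , y∈ys , y∉ ← find some
    with v∼y , y∈S ← Equivalence.to (∈ys⇔ y) y∈ys
    with d , refl ← ∼⇒⊕ v y v∼y = d , (λ d∈ds → y∉ (∈-map⁺ (v ⊕_) d∈ds)) , y∈S

-- Level function of a completely regular code

distinct₄ : {A : Set} {p q r s : A} →
            p ≢ q → p ≢ r → p ≢ s → q ≢ r → q ≢ s → r ≢ s → Unique (p ∷ q ∷ r ∷ s ∷ [])
distinct₄ p≢q p≢r p≢s q≢r q≢s r≢s =
  (p≢q ∷ p≢r ∷ p≢s ∷ []) ∷ (q≢r ∷ q≢s ∷ []) ∷ (r≢s ∷ []) ∷ [] ∷ []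

module Levels {n ρ} {C : Code n} {α : Parameters} (crc : IsCRC C ρ α) where

  open IsCRC crc

  opaque

    ℓ : Vertex n → ℕ
    ℓ v = proj₁ (proj₁ coveringRadius v)

    ℓ≤ρ : ∀ v → ℓ v ≤ ρ
    ℓ≤ρ v = proj₁ (proj₂ (proj₁ coveringRadius v))

    ℓ⇒Layer : ∀ {v} → ℓ v ≡ i → Layer C i v
    ℓ⇒Layer {v = v} refl = proj₂ (proj₂ (proj₁ coveringRadius v))

  Layer⇒ℓ : ∀ {v} → Layer C i v → ℓ v ≡ i
  Layer⇒ℓ v∈Cᵢ = Layer-unique (ℓ⇒Layer refl) v∈Cᵢ

  ℓ-cong : ∀ {v w} → v ≡ w → ℓ v ≡ i → ℓ w ≡ i
  ℓ-cong refl = id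

  ℓ≢ : ∀ {v} → ℓ v ≡ i → i ≢ j → ℓ v ≢ j
  ℓ≢ ℓv≡i i≢j ℓv≡j = i≢j (trans (sym ℓv≡i) ℓv≡j)

  ∃-code : ∃[ x ] ℓ x ≡ 0
  ∃-code with _ , (x , x∈C , _) , _ ← proj₂ coveringRadius = x , Layer⇒ℓ (code⇒Layer-0 x∈C)

  ℓ-descend : ∀ {v} → ℓ v ≡ suc i → ∃[ d ] ℓ (v ⊕ d) ≡ i
  ℓ-descend ℓv≡1+i with d , v⊕d∈Cᵢ ← Layer-descend (ℓ⇒Layer ℓv≡1+i) = d , Layer⇒ℓ v⊕d∈Cᵢ

  -- Descent from a vertex at level `ρ` passes through every smaller level.
  ∃-level : i ≤ ρ → ∃[ v ] ℓ v ≡ i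
  ∃-level {i} i≤ρ with v , v∈Cρ ← proj₂ coveringRadius =
    below v (≤-trans i≤ρ (≤-reflexive (sym (Layer⇒ℓ v∈Cρ)))) refl
    where
    below : ∀ {k} v → i ≤ k → ℓ v ≡ k → ∃[ w ] ℓ w ≡ i
    below {k} v i≤k ℓv≡k with i ≟ k
    ... | yes refl = v , ℓv≡k
    ... | no i≢k with ≤∧≢⇒< i≤k i≢k
    ...   | s≤s i≤k′ with d , ℓw≡k′ ← ℓ-descend ℓv≡k = below (v ⊕ d) i≤k′ ℓw≡k′

  ℓ-step : ∀ {v} d → ℓ v ≡ i → ℓ (v ⊕ d) ≤ suc i
  ℓ-step {v = v} d ℓv≡i = Layer-adjacent
    (subst (v ⊕ d ∼_) (⊕-⊖ v d) (∼-⊕ (v ⊕ d) (⊖ d))) (ℓ⇒Layer ℓv≡i) (ℓ⇒Layer refl)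

  at-most : ∀ {v ds} → ℓ v ≡ i → Unique ds → All (λ d → ℓ (v ⊕ d) ≡ j) ds → j ≤ ρ → length ds ≤ α i j
  at-most {v = v} refl uniq all j≤ρ =
    NeighbourCount-≥ (regular _ _ (ℓ≤ρ v) j≤ρ v (ℓ⇒Layer refl)) uniq (All.map ℓ⇒Layer all)

  another : ∀ {v} ds → ℓ v ≡ i → j ≤ ρ → length ds < α i j → ∃[ d ] (d ∉ ds × ℓ (v ⊕ d) ≡ j)
  another {v = v} ds refl j≤ρ <α
    with d , d∉ds , v⊕d∈Cⱼ ← NeighbourCount-> ds (regular _ _ (ℓ≤ρ v) j≤ρ v (ℓ⇒Layer refl)) <α =
    d , d∉ds , Layer⇒ℓ v⊕d∈Cⱼ

  -- By regularity a single vertex determines the whole entry `α i j`.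
  exactly : ∀ {v} ds → ℓ v ≡ i → j ≤ ρ → Unique ds → All (λ d → ℓ (v ⊕ d) ≡ j) ds →
            (∀ d → d ∉ ds → ℓ (v ⊕ d) ≢ j) → α i j ≡ length ds
  exactly ds ℓv≡i j≤ρ uniq all others = ≤-antisym
    (≮⇒≥ λ <α → let d , d∉ds , ℓ≡j = another ds ℓv≡i j≤ρ <α in others d d∉ds ℓ≡j)
    (at-most ℓv≡i uniq all j≤ρ)

-- Levels 0, 1 and 2 of a 2-null code with c₂ = 3

module TwoNull {n ρ} {C : Code n} {α : Parameters} (crc : IsCRC C ρ α)
               (null : IsNull 2 α) (2≤ρ : 2 ≤ ρ) (c₂≡3 : c α 2 ≡ 3) where

  open Levels crc public

  1≤ρ : 1 ≤ ρ
  1≤ρ = ≤-trans (n≤1+n 1) 2≤ρ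

  next-to-code : ∀ {v} d → ℓ v ≡ 0 → ℓ (v ⊕ d) ≡ 1
  next-to-code {v} d ℓv≡0 with ℓ (v ⊕ d) in eq | ℓ-step d ℓv≡0
  ... | 0 | _ = contradiction
    (subst (1 ≤_) (null 0 (s≤s z≤n)) (at-most ℓv≡0 ([] ∷ []) (eq ∷ []) z≤n)) λ ()
  ... | 1 | _ = refl
  ... | suc (suc _) | s≤s ()

  near-code : ∀ {v} d → ℓ (v ⊕ d) ≡ 0 → ℓ v ≡ 1
  near-code {v} d ℓ≡0 = subst (λ w → ℓ w ≡ 1) (⊕-⊖ v d) (next-to-code (⊖ d) ℓ≡0)

  next-to-level-1 : ∀ {v} d → ℓ v ≡ 1 → ℓ (v ⊕ d) ≢ 0 → ℓ (v ⊕ d) ≡ 2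
  next-to-level-1 {v} d ℓv≡1 ℓ≢0 with ℓ (v ⊕ d) in eq | ℓ-step d ℓv≡1
  ... | 0 | _ = contradiction refl ℓ≢0
  ... | 1 | _ = contradiction
    (subst (1 ≤_) (null 1 (s≤s (s≤s z≤n))) (at-most ℓv≡1 ([] ∷ []) (eq ∷ []) 1≤ρ)) λ ()
  ... | 2 | _ = refl
  ... | suc (suc (suc _)) | s≤s (s≤s ())

  at-most-three : ∀ {v p q r s} → ℓ v ≡ 2 → Unique (p ∷ q ∷ r ∷ s ∷ []) →
                  ℓ (v ⊕ p) ≡ 1 → ℓ (v ⊕ q) ≡ 1 → ℓ (v ⊕ r) ≡ 1 → ℓ (v ⊕ s) ≡ 1 → ⊥
  at-most-three ℓv≡2 uniq p q r s =
    1+n≰n (subst (4 ≤_) c₂≡3 (at-most ℓv≡2 uniq (p ∷ q ∷ r ∷ s ∷ []) 1≤ρ))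

  -- Going back returns to `v` itself; hence the second step from `v` to a codeword never undoes the
  -- first.
  ℓ≡2⇒back≢0 : ∀ {v} p → ℓ v ≡ 2 → ℓ (v ⊕ p ⊕ ⊖ p) ≢ 0
  ℓ≡2⇒back≢0 {v} p ℓv≡2 ℓ≡0 with () ← trans (sym ℓv≡2) (subst (λ w → ℓ w ≡ 0) (⊕-⊖ v p) ℓ≡0)

  -- Both orders of the two steps reach the same codeword, which makes the relation "`v ⊕ p ⊕ q` is
  -- a codeword" symmetric in `p` and `q`.
  flip-near : ∀ {v} p q → ℓ (v ⊕ p ⊕ q) ≡ 0 → ℓ (v ⊕ q) ≡ 1
  flip-near {v} p q ℓ≡0 = near-code p (subst (λ w → ℓ w ≡ 0) (⊕-comm v p q) ℓ≡0)

-- The case c₁ = 2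

module NoTwoThree {n ρ} {C : Code n} {α : Parameters} (crc : IsCRC C ρ α)
                  (null : IsNull 2 α) (2≤ρ : 2 ≤ ρ) (c₁≡2 : c α 1 ≡ 2) (c₂≡3 : c α 2 ≡ 3) where

  open TwoNull crc null 2≤ρ c₂≡3

  at-most-two : ∀ {v p q r} → p ≢ q → p ≢ r → q ≢ r →
                ℓ (v ⊕ p) ≡ 0 → ℓ (v ⊕ q) ≡ 0 → ℓ (v ⊕ r) ≡ 0 → ⊥
  at-most-two {p = d} p≢q p≢r q≢r p q r =
    1+n≰n (subst (3 ≤_) c₁≡2
      (at-most (near-code d p) ((p≢q ∷ p≢r ∷ []) ∷ (q≢r ∷ []) ∷ [] ∷ []) (p ∷ q ∷ r ∷ []) z≤n))

  other-code : ∀ {v} p → ℓ v ≡ 1 → ∃[ q ] (q ≢ p × ℓ (v ⊕ q) ≡ 0)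
  other-code p ℓv≡1 with q , q∉ , ℓ≡0 ← another (p ∷ []) ℓv≡1 z≤n (subst (1 <_) (sym c₁≡2) ≤-refl) =
    q , (λ q≡p → q∉ (here q≡p)) , ℓ≡0

  -- One of the two codewords next to v ⊕ p is not v ⊕ p ⊕ p.
  partner : ∀ {v p} → ℓ v ≡ 2 → ℓ (v ⊕ p) ≡ 1 → ∃[ q ] (q ≢ p × q ≢ ⊖ p × ℓ (v ⊕ p ⊕ q) ≡ 0)
  partner {v} {p} ℓv≡2 ℓ≡1 with q , q≢p , ℓ≡0 ← other-code p ℓ≡1 =
    q , q≢p , (λ { refl → ℓ≡2⇒back≢0 p ℓv≡2 ℓ≡0 }) , ℓ≡0

  -- Let `g` lead to the second codeword next to `y ⊕ p`. Then z = y + p + q lies in C₂ and has the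
  -- C₁-neighbours z - q, z - p, z + m and z + g.
  no-skew-path : ∀ {y m p q} → ℓ y ≡ 2 → axis m ≢ axis p → axis m ≢ axis q → axis p ≢ axis q →
                 ℓ (y ⊕ m ⊕ p) ≡ 0 → ℓ (y ⊕ m ⊕ q) ≡ 0 → ⊥
  no-skew-path {y} {m} {p} {q} ℓy≡2 m≢p m≢q p≢q mp mq
    with g , g≢m , pg ← other-code m (flip-near m p mp) =
    at-most-three ℓz≡2
      (distinct₄ (axis≢⇒≢ (⊖-axisˡ (⊖-axisʳ (≢-sym p≢q)))) (axis≢⇒≢ (⊖-axisˡ (≢-sym m≢q))) (⊖q≢g pg)
                 (axis≢⇒≢ (⊖-axisˡ (≢-sym m≢p))) (λ { refl → ℓ≡2⇒back≢0 p ℓy≡2 pg }) (≢-sym g≢m))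
      (ℓ-cong (sym (⊕-⊖ (y ⊕ p) q)) ℓp≡1)
      (ℓ-cong (sym (⊕⊕-⊖ y p q)) (flip-near m q mq))
      (near-code (⊖ q) (ℓ-cong (trans (⊕-comm y m p) (sym (⊕⊕-⊖ (y ⊕ p) q m))) mp))
      (near-code (⊖ q) (ℓ-cong (sym (⊕⊕-⊖ (y ⊕ p) q g)) pg))
    where
    ℓp≡1 = flip-near m p mp

    -- Otherwise y ⊕ m ⊕ p ⊕ q would have three neighbours in the code.
    ℓz≢0 : ℓ (y ⊕ p ⊕ q) ≢ 0
    ℓz≢0 pq = at-most-two {v = y ⊕ m ⊕ p ⊕ q}
      (axis≢⇒≢ (⊖-axisˡ (⊖-axisʳ (≢-sym p≢q)))) (axis≢⇒≢ (⊖-axisˡ (⊖-axisʳ (≢-sym m≢q))))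
      (axis≢⇒≢ (⊖-axisˡ (⊖-axisʳ (≢-sym m≢p))))
      (ℓ-cong (sym (⊕-⊖ (y ⊕ m ⊕ p) q)) mp)
      (ℓ-cong (sym (⊕⊕-⊖ (y ⊕ m) p q)) mq)
      (ℓ-cong (sym (⊕⊕⊕-⊖ y m p q)) pq)

    ℓz≡2 : ℓ (y ⊕ p ⊕ q) ≡ 2
    ℓz≡2 = next-to-level-1 q ℓp≡1 ℓz≢0

    ⊖q≢g : ∀ {g} → ℓ (y ⊕ p ⊕ g) ≡ 0 → ⊖ q ≢ g
    ⊖q≢g pg refl = at-most-three ℓy≡2
      (distinct₄ (axis≢⇒≢ (≢-sym m≢p)) (axis≢⇒≢ p≢q) (axis≢⇒≢ (⊖-axisʳ p≢q))
                 (axis≢⇒≢ m≢q) (axis≢⇒≢ (⊖-axisʳ m≢q)) (d≢⊖d q))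
      ℓp≡1 (near-code p mp) (flip-near m q mq) (flip-near p (⊖ q) pg)

  -- `m`, `p` and `⊖ p` already use up all three directions from `v` to C₁. A codeword next to
  -- `v ⊕ p` in a direction `g` other than `m` makes `v ⊕ g` lie in C₁, so `g` can only be `p`.
  go-straight : ∀ {v m p} → ℓ v ≡ 2 → axis m ≢ axis p →
                ℓ (v ⊕ m) ≡ 1 → ℓ (v ⊕ p) ≡ 1 → ℓ (v ⊕ ⊖ p) ≡ 1 → ℓ (v ⊕ p ⊕ p) ≡ 0
  go-straight {v} {m} {p} ℓv≡2 m≢p ℓm≡1 ℓp≡1 ℓ⊖p≡1
    with g , g≢m , pg ← other-code m ℓp≡1
    with g ≟ᵈ p
  ... | yes refl = pg
  ... | no g≢p = ⊥-elim (at-most-three ℓv≡2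
    (distinct₄ (axis≢⇒≢ m≢p) (axis≢⇒≢ (⊖-axisʳ m≢p)) (≢-sym g≢m) (d≢⊖d p) (≢-sym g≢p)
               (λ { refl → ℓ≡2⇒back≢0 p ℓv≡2 pg }))
    ℓm≡1 ℓp≡1 ℓ⊖p≡1 (flip-near p g pg))

  -- `go-straight` is used at `y` and, mirrored along `m`, at y + 2m. It makes y + 2p and y + 2m +
  -- 2p codewords, both next to y + m + 2p, as is y + m + p.
  no-straight-path : ∀ {y m p} → ℓ y ≡ 2 → axis m ≢ axis p →
                     ℓ (y ⊕ m ⊕ p) ≡ 0 → ℓ (y ⊕ m ⊕ ⊖ p) ≡ 0 → ⊥
  no-straight-path {y} {m} {p} ℓy≡2 m≢p mp m⊖p = at-most-two {v = y ⊕ m ⊕ p ⊕ p}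
    (axis≢⇒≢ (⊖-axisˡ (⊖-axisʳ (≢-sym m≢p)))) (axis≢⇒≢ (⊖-axisˡ (≢-sym m≢p))) (≢-sym (d≢⊖d m))
    (ℓ-cong (sym (⊕-⊖ (y ⊕ m ⊕ p) p)) mp)
    (ℓ-cong (sym (⊕⊕⊕-⊖ y m p p)) pp)
    (ℓ-cong (trans (cong (_⊕ p) (⊕-comm (y ⊕ m) m p)) (⊕-comm (y ⊕ m ⊕ p) m p)) mmpp)
    where
    ℓm≡1 = near-code p mp

    pp : ℓ (y ⊕ p ⊕ p) ≡ 0
    pp = go-straight ℓy≡2 m≢p ℓm≡1 (flip-near m p mp) (flip-near m (⊖ p) m⊖p)

    ℓmm≡2 : ℓ (y ⊕ m ⊕ m) ≡ 2
    ℓmm≡2 = next-to-level-1 m ℓm≡1 λ mm →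
      at-most-two (d≢⊖d p) (≢-sym (axis≢⇒≢ m≢p)) (axis≢⇒≢ (⊖-axisˡ (≢-sym m≢p))) mp m⊖p mm

    mmpp : ℓ (y ⊕ m ⊕ m ⊕ p ⊕ p) ≡ 0
    mmpp = go-straight ℓmm≡2 (⊖-axisˡ m≢p)
      (ℓ-cong (sym (⊕-⊖ (y ⊕ m) m)) ℓm≡1)
      (near-code (⊖ m) (ℓ-cong (sym (⊕⊕-⊖ (y ⊕ m) m p)) mp))
      (near-code (⊖ m) (ℓ-cong (sym (⊕⊕-⊖ (y ⊕ m) m (⊖ p))) m⊖p))

  no-path : ∀ {y m p q} → ℓ y ≡ 2 → axis m ≢ axis p → axis m ≢ axis q → p ≢ q →
            ℓ (y ⊕ m ⊕ p) ≡ 0 → ℓ (y ⊕ m ⊕ q) ≡ 0 → ⊥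
  no-path {y} {m} {p} {q} ℓy≡2 m≢p m≢q p≢q mp mq with q ≟ᵈ (⊖ p)
  ... | yes refl = no-straight-path ℓy≡2 m≢p mp mq
  ... | no q≢⊖p = no-skew-path ℓy≡2 m≢p m≢q (≢-sym (≢∧≢⊖⇒axis≢ (≢-sym p≢q) q≢⊖p)) mp mq

  impossible : ⊥
  impossible
    with y , ℓy≡2 ← ∃-level 2≤ρ
    with p , ℓp≡1 ← ℓ-descend ℓy≡2
    with q , q≢p , q≢⊖p , pq ← partner ℓy≡2 ℓp≡1
    with r , r∉ , ℓr≡1 ← another (p ∷ q ∷ []) ℓy≡2 1≤ρ (subst (2 <_) (sym c₂≡3) ≤-refl)
    with s , s≢r , s≢⊖r , rs ← partner ℓy≡2 ℓr≡1
    -- `p`, `q`, `r` and `s` all lead from `y` to C₁, so two of them coincide. As `s` differs from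
    -- `r`, it is `p` or `q`, and that one is the middle of the path.
    with s ≟ᵈ p | s ≟ᵈ q
  ... | yes refl | _ = no-path ℓy≡2 (≢-sym (≢∧≢⊖⇒axis≢ q≢p q≢⊖p)) (≢∧≢⊖⇒axis≢ s≢r s≢⊖r)
    (λ { refl → r∉ (there (here refl)) }) pq (subst (λ w → ℓ w ≡ 0) (⊕-comm y r p) rs)
  ... | no _ | yes refl = no-path ℓy≡2 (≢∧≢⊖⇒axis≢ q≢p q≢⊖p) (≢∧≢⊖⇒axis≢ s≢r s≢⊖r)
    (λ { refl → r∉ (here refl) })
    (subst (λ w → ℓ w ≡ 0) (⊕-comm y p q) pq) (subst (λ w → ℓ w ≡ 0) (⊕-comm y r q) rs)
  ... | no s≢p | no s≢q = at-most-three ℓy≡2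
    (distinct₄ (≢-sym q≢p) (λ { refl → r∉ (here refl) }) (≢-sym s≢p)
               (λ { refl → r∉ (there (here refl)) }) (≢-sym s≢q) (≢-sym s≢r))
    ℓp≡1 (flip-near p q pq) ℓr≡1 (flip-near r s rs)

-- The case c₁ = 1

module OneThree {n ρ} {C : Code n} {α : Parameters} (crc : IsCRC C ρ α)
                (null : IsNull 2 α) (2≤ρ : 2 ≤ ρ) (c₁≡1 : c α 1 ≡ 1) (c₂≡3 : c α 2 ≡ 3) where

  open TwoNull crc null 2≤ρ c₂≡3 public

  code-unique : ∀ {v p q} → ℓ (v ⊕ p) ≡ 0 → ℓ (v ⊕ q) ≡ 0 → p ≡ q
  code-unique {p = p} {q} ℓp≡0 ℓq≡0 = decidable-stable (p ≟ᵈ q) λ p≢q →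
    1+n≰n (subst (2 ≤_) c₁≡1
      (at-most (near-code p ℓp≡0) ((p≢q ∷ []) ∷ [] ∷ []) (ℓp≡0 ∷ ℓq≡0 ∷ []) z≤n))

  -- As c₁ = 1, `x` is the only codeword next to `x ⊕ d`.
  two-steps : ∀ {x} d e → ℓ x ≡ 0 → e ≢ ⊖ d → ℓ (x ⊕ d ⊕ e) ≡ 2
  two-steps {x} d e ℓx≡0 e≢⊖d = next-to-level-1 e (next-to-code d ℓx≡0) λ ℓ≡0 →
    e≢⊖d (code-unique ℓ≡0 (ℓ-cong (sym (⊕-⊖ x d)) ℓx≡0))

  -- The arrow from `d` to `e`: the codeword x + 3d + e. The steps are ordered so that `near-code`
  -- and `flip-near` apply at x + 2d.
  record Knight (x : Vertex n) (d e : Dir n) : Set where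
    constructor leap
    field codeword : ℓ (x ⊕ d ⊕ d ⊕ e ⊕ d) ≡ 0

  -- Out-degree at most one: otherwise x + 2d in C₂ has the C₁-neighbours x + d, x + 3d, x + 2d + e
  -- and x + 2d + f.
  knight-unique : ∀ {x d e f} → ℓ x ≡ 0 → axis d ≢ axis e → axis d ≢ axis f →
                  Knight x d e → Knight x d f → e ≡ f
  knight-unique {x} {d} {e} {f} ℓx≡0 d≢e d≢f (leap de) (leap df) = decidable-stable (e ≟ᵈ f) λ e≢f →
    at-most-three (two-steps d d ℓx≡0 (d≢⊖d d))
      (distinct₄ (≢-sym (d≢⊖d d)) (axis≢⇒≢ (⊖-axisˡ d≢e)) (axis≢⇒≢ (⊖-axisˡ d≢f))
                 (axis≢⇒≢ d≢e) (axis≢⇒≢ d≢f) e≢f)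
      (ℓ-cong (sym (⊕-⊖ (x ⊕ d) d)) (next-to-code d ℓx≡0))
      (flip-near e d de) (near-code d de) (near-code d df)

  -- `f` leads from y = x + d + e to its third C₁-neighbour, and `g` from there to a codeword. If
  -- `g` were `⊖ e` or `⊖ d`, then x + d or x + e would have a second codeword; any other `g`
  -- distinct from `f` would give `y` a fourth C₁-neighbour.
  third-codeword : ∀ {x d e} → ℓ x ≡ 0 → axis d ≢ axis e →
                   ∃[ f ] (f ≢ ⊖ d × f ≢ ⊖ e × ℓ (x ⊕ d ⊕ e ⊕ f ⊕ f) ≡ 0)
  third-codeword {x} {d} {e} ℓx≡0 d≢e
    with ℓy≡2 ← two-steps d e ℓx≡0 (axis≢⇒≢ (⊖-axisʳ (≢-sym d≢e)))
    with f , f∉ , ℓf≡1 ← another (⊖ e ∷ ⊖ d ∷ []) ℓy≡2 1≤ρ (subst (2 <_) (sym c₂≡3) ≤-refl)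
    with g , fg ← ℓ-descend ℓf≡1
    with g ≟ᵈ f | g ≟ᵈ (⊖ e) | g ≟ᵈ (⊖ d)
  ... | yes refl | _ | _ = f , (λ f≡⊖d → f∉ (there (here f≡⊖d))) , (λ f≡⊖e → f∉ (here f≡⊖e)) , fg
  ... | no _ | yes refl | _ = contradiction
    (there (here (code-unique (ℓ-cong (⊕-comm (x ⊕ d ⊕ e) f (⊖ e)) fg)
      (ℓ-cong (sym (trans (cong (_⊕ ⊖ d) (⊕-⊖ (x ⊕ d) e)) (⊕-⊖ x d))) ℓx≡0)))) f∉
  ... | no _ | no _ | yes refl = contradiction
    (here (code-unique (ℓ-cong (⊕-comm (x ⊕ d ⊕ e) f (⊖ d)) fg)
      (ℓ-cong (sym (trans (cong (_⊕ ⊖ e) (⊕⊕-⊖ x d e)) (⊕-⊖ x e))) ℓx≡0))) f∉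
  ... | no g≢f | no g≢⊖e | no g≢⊖d = ⊥-elim (at-most-three ℓy≡2
    (distinct₄ (axis≢⇒≢ (⊖-axisˡ (⊖-axisʳ (≢-sym d≢e)))) (λ { refl → f∉ (here refl) }) (≢-sym g≢⊖e)
               (λ { refl → f∉ (there (here refl)) }) (≢-sym g≢⊖d) (≢-sym g≢f))
    (ℓ-cong (sym (⊕-⊖ (x ⊕ d) e)) (next-to-code d ℓx≡0))
    (ℓ-cong (sym (⊕⊕-⊖ x d e)) (next-to-code e ℓx≡0))
    ℓf≡1 (flip-near f g fg))

  -- It remains to exclude an `f` on a third axis: then x + d + f in C₂ has the C₁-neighbours x + d,
  -- x + f, x + d + f + e and x + d + 2f.
  knight : ∀ {x d e} → ℓ x ≡ 0 → axis d ≢ axis e → Knight x d e ⊎ Knight x e d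
  knight {x} {d} {e} ℓx≡0 d≢e
    with f , f≢⊖d , f≢⊖e , ff ← third-codeword ℓx≡0 d≢e
    with f ≟ᵈ d | f ≟ᵈ e
  ... | yes refl | _ = inj₁ (leap (ℓ-cong (cong (_⊕ d) (⊕-comm (x ⊕ d) e d)) ff))
  ... | no _ | yes refl = inj₂ (leap (ℓ-cong (cong (_⊕ e)
    (trans (cong (_⊕ e) (⊕-comm x d e)) (⊕-comm (x ⊕ e) d e))) ff))
  ... | no f≢d | no f≢e = ⊥-elim (at-most-three (two-steps d f ℓx≡0 f≢⊖d)
    (distinct₄ (axis≢⇒≢ (⊖-axisˡ (⊖-axisʳ f≢ₐd))) (axis≢⇒≢ (⊖-axisˡ f≢ₐe)) (≢-sym (d≢⊖d f))
               (axis≢⇒≢ (⊖-axisˡ d≢e)) (≢-sym f≢⊖d) (≢-sym f≢e))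
    (ℓ-cong (sym (⊕-⊖ (x ⊕ d) f)) (next-to-code d ℓx≡0))
    (ℓ-cong (sym (⊕⊕-⊖ x d f)) (next-to-code f ℓx≡0))
    (ℓ-cong (⊕-comm (x ⊕ d) e f) (near-code f ff))
    (near-code e (ℓ-cong (trans (cong (_⊕ f) (⊕-comm (x ⊕ d) e f)) (⊕-comm (x ⊕ d ⊕ f) e f)) ff)))
    where
    f≢ₐd : axis f ≢ axis d
    f≢ₐd = ≢∧≢⊖⇒axis≢ f≢d f≢⊖d

    f≢ₐe : axis f ≢ axis e
    f≢ₐe = ≢∧≢⊖⇒axis≢ f≢e f≢⊖e

  -- The arrow to `e` exhausts the out-degree of `d`, so the pair of `d` and `f` is oriented towards
  -- `d`.
  turn-knight : ∀ {x d e f} → ℓ x ≡ 0 → axis d ≢ axis e → axis d ≢ axis f → e ≢ f →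
                Knight x d e → Knight x f d
  turn-knight ℓx≡0 d≢e d≢f e≢f de =
    [ (λ df → contradiction (knight-unique ℓx≡0 d≢e d≢f de df) e≢f) , id ]′ (knight ℓx≡0 d≢f)

  -- Orienting the five edges between q, r, p and ⊖ p by knights forces
  -- out-degree two at r.
  no-third-axis : ∀ {x p q r} → ℓ x ≡ 0 → axis p ≢ axis q → axis p ≢ axis r → axis q ≢ axis r →
                  ¬ Knight x q r
  no-third-axis {x} {p} {q} {r} ℓx≡0 p≢q p≢r q≢r qr =
    d≢⊖d p (knight-unique ℓx≡0 (≢-sym p≢r) (⊖-axisʳ (≢-sym p≢r))
      (back p≢q p≢r) (back (⊖-axisˡ p≢q) (⊖-axisˡ p≢r)))
    where
    back : ∀ {s} → axis s ≢ axis q → axis s ≢ axis r → Knight x r s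
    back s≢q s≢r = turn-knight ℓx≡0 s≢q s≢r (axis≢⇒≢ q≢r)
      (turn-knight ℓx≡0 q≢r (≢-sym s≢q) (axis≢⇒≢ (≢-sym s≢r)) qr)

  two-axes : ∀ {x p q r} → ℓ x ≡ 0 → axis p ≢ axis q → axis p ≢ axis r → axis q ≢ axis r → ⊥
  two-axes ℓx≡0 p≢q p≢r q≢r =
    [ no-third-axis ℓx≡0 p≢q p≢r q≢r , no-third-axis ℓx≡0 p≢r p≢q (≢-sym q≢r) ]′ (knight ℓx≡0 q≢r)

-- Dimension two: the parameter matrix is forced

Fin2-cover : {i j : Fin 2} → i ≢ j → ∀ k → k ≡ i ⊎ k ≡ j
Fin2-cover {zero}     {zero}     i≢j _          = contradiction refl i≢j
Fin2-cover {zero}     {suc zero} _   zero       = inj₁ refl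
Fin2-cover {zero}     {suc zero} _   (suc zero) = inj₂ refl
Fin2-cover {suc zero} {zero}     _   zero       = inj₂ refl
Fin2-cover {suc zero} {zero}     _   (suc zero) = inj₁ refl
Fin2-cover {suc zero} {suc zero} i≢j _          = contradiction refl i≢j

four-directions : {d e : Dir 2} → axis d ≢ axis e → (P : Dir 2 → Set) →
                  P d → P (⊖ d) → P e → P (⊖ e) → ∀ f → P f
four-directions d≢e P Pd P⊖d Pe P⊖e f with Fin2-cover d≢e (axis f)
... | inj₁ f≡d with axis≡⇒≡⊎≡⊖ f≡d
...   | inj₁ refl = Pd
...   | inj₂ refl = P⊖d
four-directions d≢e P Pd P⊖d Pe P⊖e f | inj₂ f≡e with axis≡⇒≡⊎≡⊖ f≡e
...   | inj₁ refl = Pe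
...   | inj₂ refl = P⊖e

opaque
  unfolding axis

  axis≢ : {i j : Fin n} {s t : Sign} → i ≢ j → axis (i , s) ≢ axis (j , t)
  axis≢ i≢j = i≢j


matrix : List (List ℕ)
matrix = (0 ∷ 4 ∷ []) ∷ (1 ∷ 0 ∷ 3 ∷ []) ∷ (3 ∷ 0 ∷ 1 ∷ []) ∷ (4 ∷ 0 ∷ []) ∷ []

matrix-from-entries : ∀ {ρ} α → ρ ≡ 3 → α 0 0 ≡ 0 → α 0 1 ≡ 4 → α 1 0 ≡ 1 → α 1 1 ≡ 0 → α 1 2 ≡ 3 →
                      α 2 1 ≡ 3 → α 2 2 ≡ 0 → α 2 3 ≡ 1 → α 3 2 ≡ 4 → α 3 3 ≡ 0 →
                      parameterMatrix α ρ ≡ matrix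
matrix-from-entries _ refl p q r s t u v w y z
  rewrite p | q | r | s | t | u | v | w | y | z = refl

module Planar {ρ} {C : Code 2} {α : Parameters} (crc : IsCRC C ρ α)
              (null : IsNull 2 α) (2≤ρ : 2 ≤ ρ) (c₁≡1 : c α 1 ≡ 1) (c₂≡3 : c α 2 ≡ 3) where

  open OneThree crc null 2≤ρ c₁≡1 c₂≡3

  module _ {x : Vertex 2} {d e : Dir 2} (ℓx≡0 : ℓ x ≡ 0) (d≢e : axis d ≢ axis e) (de : Knight x d e) where

    -- The four knights around x are the quarter turns of the given one.
    e⊖d : ℓ (x ⊕ e ⊕ e ⊕ ⊖ d ⊕ e) ≡ 0
    e⊖d = subst (λ f → ℓ (x ⊕ f ⊕ f ⊕ ⊖ d ⊕ f) ≡ 0) (⊖-involutive e) (Knight.codeword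
      (quarter (⊖-axisˡ (⊖-axisʳ d≢e)) (quarter (⊖-axisˡ (≢-sym d≢e)) (quarter d≢e de))))
      where
      -- `d` already points to `e`, so `⊖ e` points to `d`. Three such turns end with the arrow from
      -- `⊖ ⊖ e` to `⊖ d`.
      quarter : ∀ {d e} → axis d ≢ axis e → Knight x d e → Knight x (⊖ e) d
      quarter d≢e = turn-knight ℓx≡0 d≢e (⊖-axisʳ d≢e) (d≢⊖d _)

    all-directions : Unique (d ∷ ⊖ d ∷ e ∷ ⊖ e ∷ [])
    all-directions = distinct₄ (d≢⊖d d) (axis≢⇒≢ d≢e) (axis≢⇒≢ (⊖-axisʳ d≢e))
      (axis≢⇒≢ (⊖-axisˡ d≢e)) (axis≢⇒≢ (⊖-axisˡ (⊖-axisʳ d≢e))) (d≢⊖d e)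

    far : Vertex 2
    far = x ⊕ d ⊕ e ⊕ e

    -- Each neighbour is two non-cancelling steps from a codeword: x + 2e and x + d + e from `x`, x
    -- + 2d + 2e from x + 3d + e, and x + d + 3e from x - d + 3e.
    ℓ-around-far : ∀ f → ℓ (far ⊕ f) ≡ 2
    ℓ-around-far = four-directions d≢e _
      (ℓ-cong far⊕d (two-steps (⊖ d) e (Knight.codeword de) (axis≢⇒≢ (⊖-axisʳ (⊖-axisʳ (≢-sym d≢e))))))
      (ℓ-cong (sym (⊕⊕⊕-⊖ x d e e)) (two-steps e e ℓx≡0 (d≢⊖d e)))
      (ℓ-cong far⊕e (two-steps d d e⊖d (d≢⊖d d)))
      (ℓ-cong (sym (⊕-⊖ (x ⊕ d ⊕ e) e)) (two-steps d e ℓx≡0 (axis≢⇒≢ (⊖-axisʳ (≢-sym d≢e)))))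
      where
      open ≡-Reasoning
      far⊕d : x ⊕ d ⊕ d ⊕ e ⊕ d ⊕ ⊖ d ⊕ e ≡ far ⊕ d
      far⊕d = begin
        x ⊕ d ⊕ d ⊕ e ⊕ d ⊕ ⊖ d ⊕ e ≡⟨ cong (_⊕ e) (⊕-⊖ (x ⊕ d ⊕ d ⊕ e) d) ⟩
        x ⊕ d ⊕ d ⊕ e ⊕ e           ≡⟨ cong (_⊕ e) (⊕-comm (x ⊕ d) d e) ⟩
        x ⊕ d ⊕ e ⊕ d ⊕ e           ≡⟨ ⊕-comm (x ⊕ d ⊕ e) d e ⟩
        x ⊕ d ⊕ e ⊕ e ⊕ d           ∎

      far⊕e : x ⊕ e ⊕ e ⊕ ⊖ d ⊕ e ⊕ d ⊕ d ≡ far ⊕ e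
      far⊕e = begin
        x ⊕ e ⊕ e ⊕ ⊖ d ⊕ e ⊕ d ⊕ d ≡⟨ cong (λ w → w ⊕ d ⊕ d) (⊕-comm (x ⊕ e ⊕ e) (⊖ d) e) ⟩
        x ⊕ e ⊕ e ⊕ e ⊕ ⊖ d ⊕ d ⊕ d ≡⟨ cong (_⊕ d) (⊖-⊕ (x ⊕ e ⊕ e ⊕ e) d) ⟩
        x ⊕ e ⊕ e ⊕ e ⊕ d           ≡⟨ ⊕-comm (x ⊕ e ⊕ e) e d ⟩
        x ⊕ e ⊕ e ⊕ d ⊕ e           ≡⟨ cong (_⊕ e) (⊕-comm (x ⊕ e) e d) ⟩
        x ⊕ e ⊕ d ⊕ e ⊕ e           ≡⟨ cong (λ w → w ⊕ e ⊕ e) (⊕-comm x e d) ⟩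
        x ⊕ d ⊕ e ⊕ e ⊕ e           ∎

    -- Level 0 would put the neighbours in C₁; at a positive level some neighbour is one level
    -- lower, and all of them lie in C₂.
    ℓ-far : ℓ far ≡ 3
    ℓ-far = level (ℓ far) refl
      where
      level : ∀ k → ℓ far ≡ k → ℓ far ≡ 3
      level zero    ℓ≡0   = contradiction (ℓ-around-far d) (ℓ≢ (next-to-code d ℓ≡0) λ ())
      level (suc i) ℓ≡1+i =
        let f , ℓf≡i = ℓ-descend ℓ≡1+i
        in trans ℓ≡1+i (cong suc (trans (sym ℓf≡i) (ℓ-around-far f)))

    3≤ρ : 3 ≤ ρ
    3≤ρ = subst (_≤ ρ) ℓ-far (ℓ≤ρ far)

    α₀₁ : α 0 1 ≡ 4
    α₀₁ = exactly (d ∷ ⊖ d ∷ e ∷ ⊖ e ∷ []) ℓx≡0 1≤ρ all-directions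
      (All.universal (λ f → next-to-code f ℓx≡0) _)
      (four-directions d≢e _ (contradiction (here refl)) (contradiction (there (here refl)))
        (contradiction (there (there (here refl)))) (contradiction (there (there (there (here refl))))))

    α₁₂ : α 1 2 ≡ 3
    α₁₂ = exactly (d ∷ e ∷ ⊖ e ∷ []) (next-to-code d ℓx≡0) 2≤ρ
      ((axis≢⇒≢ d≢e ∷ axis≢⇒≢ (⊖-axisʳ d≢e) ∷ []) ∷ (d≢⊖d e ∷ []) ∷ [] ∷ [])
      (two-steps d d ℓx≡0 (d≢⊖d d)
        ∷ two-steps d e ℓx≡0 (axis≢⇒≢ (⊖-axisʳ (≢-sym d≢e)))
        ∷ two-steps d (⊖ e) ℓx≡0 (axis≢⇒≢ (⊖-axisˡ (⊖-axisʳ (≢-sym d≢e)))) ∷ [])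
      (four-directions d≢e _ (contradiction (here refl))
        (λ _ → ℓ≢ (ℓ-cong (sym (⊕-⊖ x d)) ℓx≡0) λ ())
        (contradiction (there (here refl))) (contradiction (there (there (here refl)))))

    -- The remaining entries of row 2 are read off at x + 2e. One neighbour is `far`; x + 2e - d and
    -- x + 3e lie next to the codeword x - d + 3e, and x + e next to `x`.
    ee⊕d : ℓ (x ⊕ e ⊕ e ⊕ d) ≡ 3
    ee⊕d = ℓ-cong (trans (cong (_⊕ e) (⊕-comm x d e)) (⊕-comm (x ⊕ e) d e)) ℓ-far

    ee⊕⊖d : ℓ (x ⊕ e ⊕ e ⊕ ⊖ d) ≡ 1
    ee⊕⊖d = near-code e e⊖d

    ee⊕e : ℓ (x ⊕ e ⊕ e ⊕ e) ≡ 1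
    ee⊕e = flip-near (⊖ d) e e⊖d

    ee⊕⊖e : ℓ (x ⊕ e ⊕ e ⊕ ⊖ e) ≡ 1
    ee⊕⊖e = ℓ-cong (sym (⊕-⊖ (x ⊕ e) e)) (next-to-code e ℓx≡0)

    α₂₂ : α 2 2 ≡ 0
    α₂₂ = exactly [] (two-steps e e ℓx≡0 (d≢⊖d e)) 2≤ρ [] []
      (four-directions d≢e _ (λ _ → ℓ≢ ee⊕d λ ()) (λ _ → ℓ≢ ee⊕⊖d λ ())
        (λ _ → ℓ≢ ee⊕e λ ()) (λ _ → ℓ≢ ee⊕⊖e λ ()))

    α₂₃ : α 2 3 ≡ 1
    α₂₃ = exactly (d ∷ []) (two-steps e e ℓx≡0 (d≢⊖d e)) 3≤ρ ([] ∷ []) (ee⊕d ∷ [])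
      (four-directions d≢e _ (contradiction (here refl)) (λ _ → ℓ≢ ee⊕⊖d λ ())
        (λ _ → ℓ≢ ee⊕e λ ()) (λ _ → ℓ≢ ee⊕⊖e λ ()))

    α₃₂ : α 3 2 ≡ 4
    α₃₂ = exactly (d ∷ ⊖ d ∷ e ∷ ⊖ e ∷ []) ℓ-far 2≤ρ all-directions (All.universal ℓ-around-far _)
      (four-directions d≢e _ (contradiction (here refl)) (contradiction (there (here refl)))
        (contradiction (there (there (here refl)))) (contradiction (there (there (there (here refl))))))

    α₃₃ : α 3 3 ≡ 0
    α₃₃ = exactly [] ℓ-far 3≤ρ [] [] λ f _ → ℓ≢ (ℓ-around-far f) λ ()

    ρ≡3 : ρ ≡ 3
    ρ≡3 = ≤-antisym (≮⇒≥ 4≰ρ) 3≤ρ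
      where
      4≰ρ : ¬ 4 ≤ ρ
      4≰ρ 4≤ρ =
        let w , ℓw≡4 = ∃-level 4≤ρ
            f , ℓf≡3 = ℓ-descend ℓw≡4
            -- No neighbour of `far` lies at level 4, whereas `w ⊕ f` at level 3 has the neighbour
            -- `w` there.
            α₃₄≡0    = exactly [] ℓ-far 4≤ρ [] [] λ g _ → ℓ≢ (ℓ-around-far g) λ ()
        in 1+n≰n (subst (1 ≤_) α₃₄≡0
             (at-most ℓf≡3 ([] ∷ []) (ℓ-cong (sym (⊕-⊖ w f)) ℓw≡4 ∷ []) 4≤ρ))

    matrix≡ : parameterMatrix α ρ ≡ matrix
    matrix≡ = matrix-from-entries α ρ≡3 (null 0 (s≤s z≤n)) α₀₁ c₁≡1 (null 1 (s≤s (s≤s z≤n))) α₁₂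
                c₂≡3 α₂₂ α₂₃ α₃₂ α₃₃

  parameterMatrix≡ : parameterMatrix α ρ ≡ matrix
  parameterMatrix≡ =
    let x , ℓx≡0 = ∃-code in
    [ matrix≡ ℓx≡0 (axis≢ λ ()) , matrix≡ ℓx≡0 (axis≢ λ ()) ]′
      (knight {d = zero , Sign.+} {suc zero , Sign.+} ℓx≡0 (axis≢ λ ()))

-- Excluding all other dimensions when c₁ = 1

dimension≡2 : ∀ {n ρ} {C : Code n} {α} → 1 ≤ n → Is2NullCRC 1 3 C ρ α → n ≡ 2
dimension≡2 {suc zero} _ (crc , null , 2≤ρ , c₁≡1 , c₂≡3) = ⊥-elim (two-neighbours ∃-code)
  where
  open OneThree crc null 2≤ρ c₁≡1 c₂≡3

  axes-agree : (d e : Dir 1) → axis d ≡ axis e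
  axes-agree d e with zero ← axis d | zero ← axis e = refl

  two-neighbours : ¬ (∃[ x ] ℓ x ≡ 0)
  two-neighbours (x , ℓx≡0)
    with d ← zero , Sign.+
    -- On a line a vertex of C₂ has only two neighbours, fewer than c₂ = 3.
    with f , f∉ , _ ← another (d ∷ ⊖ d ∷ []) (two-steps d d ℓx≡0 (d≢⊖d d)) 1≤ρ
                        (subst (2 <_) (sym c₂≡3) ≤-refl)
    with axis≡⇒≡⊎≡⊖ (axes-agree f d)
  ... | inj₁ f≡d  = f∉ (here f≡d)
  ... | inj₂ f≡⊖d = f∉ (there (here f≡⊖d))
dimension≡2 {suc (suc zero)} _ _ = refl
dimension≡2 {suc (suc (suc n))} _ (crc , null , 2≤ρ , c₁≡1 , c₂≡3) =
  ⊥-elim (two-axes {p = zero , Sign.+} {suc zero , Sign.+} {suc (suc zero) , Sign.+}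
    (proj₂ ∃-code) (axis≢ λ ()) (axis≢ λ ()) (axis≢ λ ()))
  where
  open OneThree crc null 2≤ρ c₁≡1 c₂≡3

-- A code with the given parameters

Walk-0⇒≡ : {v w : Vertex n} → Walk 0 v w → v ≡ w
Walk-0⇒≡ ε = refl

Walk-1⇒⊕ : {v w : Vertex n} → Walk 1 v w → ∃[ d ] w ≡ v ⊕ d
Walk-1⇒⊕ {v = v} {w} (v∼w ◅ ε) = ∼⇒⊕ v w v∼w

v≢v⊕d : ∀ (v : Vertex n) d → v ≢ v ⊕ d
v≢v⊕d v d v≡v⊕d with () ← trans (sym (weight-self v)) (subst (v ∼_) (sym v≡v⊕d) (∼-⊕ v d))

Dist-⊕ : ∀ (v : Vertex n) d → Dist v (v ⊕ d) 1
Dist-⊕ v d = ∼-⊕ v d ◅ ε ,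
  λ { zero walk → contradiction (Walk-0⇒≡ walk) (v≢v⊕d v d) ; (suc m) _ → s≤s z≤n }

-- Under these hypotheses `f` is the distance to `C`: descents give a walk of length `f v` to a
-- codeword, and the Lipschitz bound shows that no walk to a codeword is shorter.
module LevelFunction {n} {C : Code n} (f : Vertex n → ℕ)
  (code⇔ : ∀ v → v ∈ C ⇔ f v ≡ 0)
  (lipschitz : ∀ v d → f v ≤ suc (f (v ⊕ d)))
  (descend : ∀ {k} v → f v ≡ suc k → ∃[ d ] f (v ⊕ d) ≡ k) where

  walk-to-code : ∀ k v → f v ≡ k → ∃[ x ] (x ∈ C × Walk k v x)
  walk-to-code zero    v fv≡0 = v , Equivalence.from (code⇔ v) fv≡0 , ε
  walk-to-code (suc k) v fv≡1+k =
    let d , f≡k = descend v fv≡1+k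
        x , x∈C , walk = walk-to-code k (v ⊕ d) f≡k
    in x , x∈C , ∼-⊕ v d ◅ walk

  walk-bound : ∀ {m v x} → x ∈ C → Walk m v x → f v ≤ m
  walk-bound {x = x} x∈C ε = ≤-reflexive (Equivalence.to (code⇔ x) x∈C)
  walk-bound {v = v} x∈C (_◅_ {y = y} v∼y walk) with d , refl ← ∼⇒⊕ v y v∼y =
    ≤-trans (lipschitz v d) (s≤s (walk-bound x∈C walk))

  level⇒Layer : ∀ {v} → f v ≡ i → Layer C i v
  level⇒Layer {v = v} refl =
    let _ , x∈C , walk = walk-to-code (f v) v refl in minimal⇒Layer x∈C walk walk-bound

  Layer⇒level : ∀ {v} → Layer C i v → f v ≡ i
  Layer⇒level = Layer-unique (level⇒Layer refl)

module _ {A : Set} (f g : A → A) where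

  -- The integer powers of `f`, with `g` in the role of its inverse.
  iterateℤ : ℤ → A → A
  iterateℤ (+ zero)     a = a
  iterateℤ (+ suc n)    a = f (iterateℤ (+ n) a)
  iterateℤ -[1+ zero ]  a = g a
  iterateℤ -[1+ suc n ] a = g (iterateℤ -[1+ n ] a)

  iterateℤ-suc : (∀ a → f (g a) ≡ a) → ∀ z a → iterateℤ (ℤ.suc z) a ≡ f (iterateℤ z a)
  iterateℤ-suc fg (+ n)        a = refl
  iterateℤ-suc fg -[1+ zero ]  a = sym (fg a)
  iterateℤ-suc fg -[1+ suc n ] a = sym (fg _)

  iterateℤ-pred : (∀ a → g (f a) ≡ a) → ∀ z a → iterateℤ (ℤ.pred z) a ≡ g (iterateℤ z a)
  iterateℤ-pred gf (+ zero)  a = refl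
  iterateℤ-pred gf (+ suc n) a = sym (gf _)
  iterateℤ-pred gf -[1+ n ]  a = refl

  iterateℤ-comm : ∀ (h : A → A) → (∀ a → f (h a) ≡ h (f a)) → (∀ a → g (h a) ≡ h (g a)) →
                  ∀ z a → iterateℤ z (h a) ≡ h (iterateℤ z a)
  iterateℤ-comm h fh gh (+ zero)     a = refl
  iterateℤ-comm h fh gh (+ suc n)    a = trans (cong f (iterateℤ-comm h fh gh (+ n) a)) (fh _)
  iterateℤ-comm h fh gh -[1+ zero ]  a = gh a
  iterateℤ-comm h fh gh -[1+ suc n ] a = trans (cong g (iterateℤ-comm h fh gh -[1+ n ] a)) (gh _)

  iterateℤ-parity : (p : A → Parity) → (∀ a → p (f a) ≡ p a ⁻¹) → (∀ a → p (g a) ≡ p a ⁻¹) →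
                    ∀ z a → p (iterateℤ z a) ≡ parity ℤ.∣ z ∣ ℙ.+ p a
  iterateℤ-parity p pf pg = go
    where
    flip : ∀ n {b a} → p b ≡ parity n ℙ.+ p a → (p b) ⁻¹ ≡ parity (suc n) ℙ.+ p a
    flip n {b} {a} eq = trans (cong _⁻¹ eq) (lemma n (p a))
      where
      lemma : ∀ n q → (parity n ℙ.+ q) ⁻¹ ≡ parity (suc n) ℙ.+ q
      lemma zero          q = refl
      lemma (suc zero)    0ℙ = refl
      lemma (suc zero)    1ℙ = refl
      lemma (suc (suc n)) q = lemma n q

    go : ∀ z a → p (iterateℤ z a) ≡ parity ℤ.∣ z ∣ ℙ.+ p a
    go (+ zero)     a = refl
    go (+ suc n)    a = trans (pf _) (flip n (go (+ n) a))
    go -[1+ zero ]  a = pg a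
    go -[1+ suc n ] a = trans (pg _) (flip (suc n) (go -[1+ n ] a))

2∣⇒parity≡0 : ∀ {m} → 2 ∣ m → parity m ≡ 0ℙ
2∣⇒parity≡0 (divides zero    refl) = refl
2∣⇒parity≡0 (divides (suc q) refl) = 2∣⇒parity≡0 (divides q refl)

parity≡0⇒2∣ : ∀ m → parity m ≡ 0ℙ → 2 ∣ m
parity≡0⇒2∣ zero          _  = 2 ∣0
parity≡0⇒2∣ (suc (suc m)) eq = ∣m∣n⇒∣m+n ∣-refl (parity≡0⇒2∣ m eq)

-- Residues modulo 10

ℤ₁₀ : Set
ℤ₁₀ = Fin 10

shift : ℕ → ℤ₁₀ → ℤ₁₀
shift k z = (Fin.toℕ z + k) mod 10

-- The residue of x + 7 y modulo 10; hence x + 2 y modulo 5 and x + y modulo 2.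
residue : Vertex 2 → ℤ₁₀
residue (x ∷ y ∷ []) = iterateℤ (shift 7) (shift 3) y (iterateℤ (shift 1) (shift 9) x zero)

-- The action of a grid step on residues; modulo 10, 9 is -1 and 3 is -7.
turn : Dir 2 → ℤ₁₀ → ℤ₁₀
turn (zero     , Sign.+) = shift 1
turn (zero     , Sign.-) = shift 9
turn (suc zero , Sign.+) = shift 7
turn (suc zero , Sign.-) = shift 3

directions : List (Dir 2)
directions = (zero , Sign.+) ∷ (zero , Sign.-) ∷ (suc zero , Sign.+) ∷ (suc zero , Sign.-) ∷ []

∈-directions : ∀ d → d ∈ˡ directions
∈-directions (zero     , Sign.+) = here refl
∈-directions (zero     , Sign.-) = there (here refl)
∈-directions (suc zero , Sign.+) = there (there (here refl))
∈-directions (suc zero , Sign.-) = there (there (there (here refl)))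

directions-unique : Unique directions
directions-unique = distinct₄ (λ ()) (λ ()) (λ ()) (λ ()) (λ ()) (λ ())

-- Local claims about the code depend only on the residue of a vertex, so each becomes a check of
-- ten cases by evaluation.
by-inspection : {P : ℤ₁₀ → Set} (P? : ∀ z → Dec (P z)) {_ : True (Fin.all? P?)} → ∀ z → P z
by-inspection P? {t} = toWitness t

opaque
  unfolding _⊕_

  residue-⊕ : ∀ v d → residue (v ⊕ d) ≡ turn d (residue v)
  residue-⊕ (x ∷ y ∷ []) (zero , Sign.+) = trans
    (cong (iterateℤ _ _ y) (iterateℤ-suc _ _ (by-inspection λ z → shift 1 (shift 9 z) Fin.≟ z) x zero))
    (iterateℤ-comm _ _ (shift 1) (by-inspection λ z → shift 7 (shift 1 z) Fin.≟ shift 1 (shift 7 z))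
      (by-inspection λ z → shift 3 (shift 1 z) Fin.≟ shift 1 (shift 3 z)) y _)
  residue-⊕ (x ∷ y ∷ []) (zero , Sign.-) = trans
    (cong (iterateℤ _ _ y) (iterateℤ-pred _ _ (by-inspection λ z → shift 9 (shift 1 z) Fin.≟ z) x zero))
    (iterateℤ-comm _ _ (shift 9) (by-inspection λ z → shift 7 (shift 9 z) Fin.≟ shift 9 (shift 7 z))
      (by-inspection λ z → shift 3 (shift 9 z) Fin.≟ shift 9 (shift 3 z)) y _)
  residue-⊕ (x ∷ y ∷ []) (suc zero , Sign.+) =
    iterateℤ-suc _ _ (by-inspection λ z → shift 7 (shift 3 z) Fin.≟ z) y _
  residue-⊕ (x ∷ y ∷ []) (suc zero , Sign.-) =
    iterateℤ-pred _ _ (by-inspection λ z → shift 3 (shift 7 z) Fin.≟ z) y _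

-- All shifts are odd and 10 is even, so every unit step flips the parity of the residue.
parity-residue : ∀ v → parity (Fin.toℕ (residue v)) ≡ parity (weight v)
parity-residue (x ∷ y ∷ []) = begin
  parity (Fin.toℕ (residue (x ∷ y ∷ [])))
    ≡⟨ iterateℤ-parity _ _ bit (flips 7) (flips 3) y _ ⟩
  parity ℤ.∣ y ∣ ℙ.+ bit (iterateℤ (shift 1) (shift 9) x zero)
    ≡⟨ cong (parity ℤ.∣ y ∣ ℙ.+_) (iterateℤ-parity _ _ bit (flips 1) (flips 9) x zero) ⟩
  parity ℤ.∣ y ∣ ℙ.+ (parity ℤ.∣ x ∣ ℙ.+ 0ℙ)
    ≡⟨ cong (parity ℤ.∣ y ∣ ℙ.+_) (ℙ.+-identityʳ _) ⟩
  parity ℤ.∣ y ∣ ℙ.+ parity ℤ.∣ x ∣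
    ≡⟨ ℙ.+-comm (parity ℤ.∣ y ∣) _ ⟩
  parity ℤ.∣ x ∣ ℙ.+ parity ℤ.∣ y ∣
    ≡⟨ ℙ.+-homo-+ ℤ.∣ x ∣ ℤ.∣ y ∣ ⟨
  parity (ℤ.∣ x ∣ + ℤ.∣ y ∣)
    ≡⟨ cong (λ k → parity (ℤ.∣ x ∣ + k)) (+-identityʳ ℤ.∣ y ∣) ⟨
  parity (weight (x ∷ y ∷ [])) ∎
  where
  open ≡-Reasoning
  bit : ℤ₁₀ → Parity
  bit = parity ∘ Fin.toℕ

  flips : ∀ k {_ : True (Fin.all? λ z → bit (shift k z) ℙ.≟ bit z ⁻¹)} z → bit (shift k z) ≡ bit z ⁻¹
  flips k {t} = toWitness t

level : ℤ₁₀ → ℕ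
level = lookup (0 ∷ 1 ∷ 2 ∷ 1 ∷ 2 ∷ 3 ∷ 2 ∷ 1 ∷ 2 ∷ 1 ∷ [])

-- The condition is x + 2y ≡ 0 mod 5. It gives a perfect code because 0, ±1 and ±2 represent every
-- residue modulo 5 exactly once.
perfectCode : Code 2
perfectCode v = 5 ∣ Fin.toℕ (residue v)

perfectCode-isPerfect : IsPerfect perfectCode
perfectCode-isPerfect v = [ centre , off-centre ]′ (pattern-at (residue v))
  where
  Hit : ℤ₁₀ → Set
  Hit z = 5 ∣ Fin.toℕ z

  Hit? : ∀ z → Dec (Hit z)
  Hit? z = 5 ∣? Fin.toℕ z

  -- The two ways for a ball to meet the code once: in its centre only, or in exactly one of the
  -- four neighbours.
  pattern-at : ∀ z →
    (Hit z × All (λ d → ¬ Hit (turn d z)) directions) ⊎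
    (¬ Hit z × Any (λ d → Hit (turn d z) × All (λ e → Hit (turn e z) → d ≡ e) directions) directions)
  pattern-at = by-inspection λ z →
    (Hit? z ×-dec All.all? (λ d → ¬? (Hit? (turn d z))) directions) ⊎-dec
    (¬? (Hit? z) ×-dec any? (λ d → Hit? (turn d z) ×-dec
      All.all? (λ e → Hit? (turn e z) →-dec (d ≟ᵈ e)) directions) directions)

  centre : Hit (residue v) × All (λ d → ¬ Hit (turn d (residue v))) directions →
           ∃! _≡_ (λ y → y ∈ perfectCode × y ∈ ClosedBall v 1)
  centre (hit , misses) = v , (hit , 0 , z≤n , ε , λ _ _ → z≤n) , unique
    where
    unique : ∀ {y} → y ∈ perfectCode × y ∈ ClosedBall v 1 → v ≡ y
    unique (_ , zero , _ , walk , _) = Walk-0⇒≡ walk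
    unique (hit′ , suc zero , _ , walk , _) with d , refl ← Walk-1⇒⊕ walk =
      contradiction (subst Hit (residue-⊕ v d) hit′) (All.lookup misses (∈-directions d))
    unique (_ , suc (suc _) , s≤s () , _)

  off-centre : ¬ Hit (residue v) ×
               Any (λ d → Hit (turn d (residue v)) ×
                          All (λ e → Hit (turn e (residue v)) → d ≡ e) directions) directions →
               ∃! _≡_ (λ y → y ∈ perfectCode × y ∈ ClosedBall v 1)
  off-centre (miss , some) with d , hit , only-d ← Any.satisfied some =
    v ⊕ d , (subst Hit (sym (residue-⊕ v d)) hit , 1 , ≤-refl , Dist-⊕ v d) , unique
    where
    unique : ∀ {y} → y ∈ perfectCode × y ∈ ClosedBall v 1 → v ⊕ d ≡ y
    unique (hit′ , zero , _ , walk , _) =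
      contradiction (subst perfectCode (sym (Walk-0⇒≡ walk)) hit′) miss
    unique (hit′ , suc zero , _ , walk , _) with e , refl ← Walk-1⇒⊕ walk =
      cong (v ⊕_) (All.lookup only-d (∈-directions e) (subst Hit (residue-⊕ v e) hit′))
    unique (_ , suc (suc _) , s≤s () , _)

-- Even weight means even residue, and 0 is the only even multiple of 5 modulo 10; it is also the
-- only residue with `level` 0.
level-code⇔ : ∀ v → v ∈ evenWords perfectCode ⇔ level (residue v) ≡ 0
level-code⇔ v = mk⇔
  (λ (5∣r , 2∣w) → to (residue v) 5∣r (trans (parity-residue v) (2∣⇒parity≡0 2∣w)))
  (λ level≡0 → let 5∣r , even = from (residue v) level≡0
               in 5∣r , parity≡0⇒2∣ (weight v) (trans (sym (parity-residue v)) even))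
  where
  to : ∀ z → 5 ∣ Fin.toℕ z → parity (Fin.toℕ z) ≡ 0ℙ → level z ≡ 0
  to = by-inspection λ z → (5 ∣? Fin.toℕ z) →-dec ((parity (Fin.toℕ z) ℙ.≟ 0ℙ) →-dec (level z ≟ 0))

  from : ∀ z → level z ≡ 0 → 5 ∣ Fin.toℕ z × parity (Fin.toℕ z) ≡ 0ℙ
  from = by-inspection λ z → (level z ≟ 0) →-dec ((5 ∣? Fin.toℕ z) ×-dec (parity (Fin.toℕ z) ℙ.≟ 0ℙ))

level-lipschitz : ∀ v d → level (residue v) ≤ suc (level (residue (v ⊕ d)))
level-lipschitz v d rewrite residue-⊕ v d =
  All.lookup (by-inspection (λ z → All.all? (λ e → level z ≤? suc (level (turn e z))) directions) (residue v))
    (∈-directions d)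

level-descend : ∀ v → level (residue v) ≡ suc k → ∃[ d ] level (residue (v ⊕ d)) ≡ k
level-descend v level≡1+k with downhill (residue v)
  where
  downhill : ∀ z → level z ≡ 0 ⊎ Any (λ d → suc (level (turn d z)) ≡ level z) directions
  downhill = by-inspection λ z →
    (level z ≟ 0) ⊎-dec any? (λ d → suc (level (turn d z)) ≟ level z) directions
... | inj₁ level≡0 with () ← trans (sym level≡0) level≡1+k
... | inj₂ some with d , eq ← Any.satisfied some =
  d , trans (cong level (residue-⊕ v d)) (suc-injective (trans eq level≡1+k))

entries : Parameters
entries 0 1 = 4
entries 1 0 = 1
entries 1 2 = 3
entries 2 1 = 3
entries 2 3 = 1
entries 3 2 = 4
entries _ _ = 0

evenWords-isCRC : IsCRC (evenWords perfectCode) 3 entries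
evenWords-isCRC = record
  { coveringRadius = (λ v → level (residue v) , level≤3 (residue v) , level⇒Layer refl)
                   -- This vertex has residue 5, the only residue with `level` 3.
                   , (+ 5 ∷ + 0 ∷ []) , level⇒Layer refl
  ; regular        = λ i j i≤3 j≤3 v v∈Cᵢ →
                       subst (λ k → NeighbourCount v _ (entries k j)) (Layer⇒level v∈Cᵢ) (neighbours v j j≤3)
  ; tridiagonal    = λ i j i≤3 j≤3 → up-to-3 (λ i → up-to-3 (λ j → tridiagonal′ i j) j j≤3) i i≤3
  }
  where
  open LevelFunction (level ∘ residue) level-code⇔ level-lipschitz level-descend

  level≤3 : ∀ z → level z ≤ 3
  level≤3 = by-inspection λ z → level z ≤? 3

  up-to-3 : {P : ℕ → Set} → (∀ (k : Fin 4) → P (Fin.toℕ k)) → ∀ k → k ≤ 3 → P k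
  up-to-3 {P} p k k≤3 = subst P (Fin.toℕ-fromℕ< (s≤s k≤3)) (p (Fin.fromℕ< (s≤s k≤3)))

  tridiagonal′ : ∀ (i j : Fin 4) → 1 < ∣ Fin.toℕ i - Fin.toℕ j ∣ → entries (Fin.toℕ i) (Fin.toℕ j) ≡ 0
  tridiagonal′ = toWitness {a? = Fin.all? λ i → Fin.all? λ j →
    (1 <? ∣ Fin.toℕ i - Fin.toℕ j ∣) →-dec (entries (Fin.toℕ i) (Fin.toℕ j) ≟ 0)} _

  at-level : ∀ z j → List (Dir 2)
  at-level z j = filter (λ d → level (turn d z) ≟ j) directions

  at-level-count : ∀ z (j : Fin 4) → length (at-level z (Fin.toℕ j)) ≡ entries (level z) (Fin.toℕ j)
  at-level-count = by-inspection λ z → Fin.all? λ j →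
    length (at-level z (Fin.toℕ j)) ≟ entries (level z) (Fin.toℕ j)

  neighbours : ∀ v j → j ≤ 3 →
               NeighbourCount v (Layer (evenWords perfectCode) j) (entries (level (residue v)) j)
  neighbours v j j≤3 =
      map (v ⊕_) (at-level (residue v) j)
    , Unique-map⁺ (⊕-injective v) (Unique-filter⁺ (λ d → level (turn d (residue v)) ≟ j) directions-unique)
    , trans (length-map _ (at-level (residue v) j)) (up-to-3 (at-level-count (residue v)) j j≤3)
    , λ y → mk⇔ to from
    where
    to : ∀ {y} → y ∈ˡ map (v ⊕_) (at-level (residue v) j) → v ∼ y × Layer (evenWords perfectCode) j y
    to y∈
      with d , d∈ , refl ← ∈-map⁻ (v ⊕_) y∈
      with _ , level≡j ← ∈-filter⁻ (λ d → level (turn d (residue v)) ≟ j) {xs = directions} d∈ =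
      ∼-⊕ v d , level⇒Layer (trans (cong level (residue-⊕ v d)) level≡j)

    from : ∀ {y} → v ∼ y × Layer (evenWords perfectCode) j y → y ∈ˡ map (v ⊕_) (at-level (residue v) j)
    from {y} (v∼y , y∈Cⱼ) with d , refl ← ∼⇒⊕ v y v∼y =
      ∈-map⁺ (v ⊕_) (∈-filter⁺ (λ d → level (turn d (residue v)) ≟ j) (∈-directions d)
        (trans (sym (cong level (residue-⊕ v d))) (Layer⇒level y∈Cⱼ)))

evenWords-is2NullCRC : Is2NullCRC 1 3 (evenWords perfectCode) 3 entries
evenWords-is2NullCRC = evenWords-isCRC , null , s≤s (s≤s z≤n) , refl , refl
  where
  null : IsNull 2 entries
  null 0 _ = refl
  null 1 _ = refl
  null (suc (suc _)) (s≤s (s≤s ()))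

mainTheorem5 :
  let M = (0 ∷ 4 ∷ []) ∷ (1 ∷ 0 ∷ 3 ∷ []) ∷ (3 ∷ 0 ∷ 1 ∷ []) ∷ (4 ∷ 0 ∷ []) ∷ [] in
  ( (∀ (n : ℕ) → 1 ≤ n →
      (∃[ C ] ∃[ ρ ] ∃[ α ] Is2NullCRC {n} 1 3 C ρ α) ⇔ n ≡ 2)
  × (∀ (C : Code 2) ρ α → Is2NullCRC 1 3 C ρ α → parameterMatrix α ρ ≡ M)
  × (∃[ P ] (IsPerfect {2} P ×
      (∃[ ρ ] ∃[ α ] (Is2NullCRC 1 3 (evenWords P) ρ α × parameterMatrix α ρ ≡ M)))) )
  ×
  (∀ (n : ℕ) → 1 ≤ n → ¬ (∃[ C ] ∃[ ρ ] ∃[ α ] Is2NullCRC {n} 2 3 C ρ α))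
mainTheorem5 =
  ( (λ n 1≤n → mk⇔
      (λ (_ , _ , _ , code) → dimension≡2 1≤n code)
      (λ { refl → evenWords perfectCode , 3 , entries , evenWords-is2NullCRC }))
  , (λ C ρ α (crc , null , 2≤ρ , c₁≡1 , c₂≡3) → Planar.parameterMatrix≡ crc null 2≤ρ c₁≡1 c₂≡3)
  , perfectCode , perfectCode-isPerfect , 3 , entries , evenWords-is2NullCRC , refl )
  , λ n _ (_ , _ , _ , crc , null , 2≤ρ , c₁≡2 , c₂≡3) → NoTwoThree.impossible crc null 2≤ρ c₁≡2 c₂≡3
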